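{- Let $\mathcal F$ be a Fano plane, $\mathbb F$ a field of characteristic not $2$, and $\epsilon$ a multiplication factor on $\mathcal F$. If either the future $\overrightarrow{P}$ is a line for all $P\in\mathcal F$, or the past $\overleftarrow{P}$ is a line for all $P\in\mathcal F$, then $(\mathbb O_{\mathcal F},\mathbf 1,\epsilon)$ is a composition algebra.
   Context: A Fano plane is a set $\mathcal F$ of seven points together with a set of seven $3$-element subsets of $\mathcal F$ called lines, such that any two distinct points lie in a unique line and any two distinct lines meet in a unique point. The Fano cube is $V_{\mathcal F}=\mathcal F\cup\{0\}$ with the unique $\mathbb Z_2$-vector space structure with zero $0$ such that for distinct $P,Q\in\mathcal F$, $P+Q$ is the third point of the line through $P$ and $Q$. A multiplication factor is a map $\epsilon:\{(P,Q)\in\mathcal F^2:P\ne Q\}\to\{ -1,1\}$ with $\epsilon_{QP}=-\epsilon_{PQ}$; the future of $P$ is $\overrightarrow{P}=\{Q\ne P:\epsilon_{PQ}=1\}$ and the past is $\overleftarrow{P}=\{Q\ne P:\epsilon_{PQ}=-1\}$. $\mathbb O_{\mathcal F}$ is the $\mathbb F$-vector space of $\mathbb F$-valued functions on $V_{\mathcal F}$, with basis $e_P$ ($P\in V_{\mathcal F}$), $e_P$ the indicator function of $P$. The multiplication $\cdot_\epsilon$ is bilinear with $e_P\cdot_\epsilon e_Q=\epsilon_{PQ}e_{P+Q}$ for $P\ne Q$ in $\mathcal F$, $e_P\cdot_\epsilon e_P=-e_0$ for $P\in\mathcal F$, and $e_0$ a two-sided unit. $\mathbf 1$ denotes the quadratic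 form $N_{\mathbb O}(\lambda^0e_0+\sum_P\lambda^Pe_P)=(\lambda^0)^2+\sum_P(\lambda^P)^2$. $(\mathbb O_{\mathcal F},\mathbf 1,\epsilon)$ is a composition algebra iff $N_{\mathbb O}(Z\cdot_\epsilon W)=N_{\mathbb O}(Z)N_{\mathbb O}(W)$ for all $Z,W\in\mathbb O_{\mathcal F}$. -}

module Defs where

open import Level using (Level; _⊔_)
open import Data.Nat using (ℕ; zero; suc)
open import Data.Bool using (Bool; true; false; if_then_else_; _∧_; not)
open import Data.Fin using (Fin; zero; suc; _≟_)
open import Data.Fin.Subset using (Subset; _∈_; ∣_∣; inside; outside)
open import Data.Vec using (Vec; lookup; tabulate)
open import Data.Maybe using (Maybe; just; nothing)
open import Data.List using (List; []; _∷_; map; foldr)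
open import Data.Product using (Σ; ∃; ∃!; _×_; _,_)
open import Relation.Nullary using (¬_; yes; no)
open import Relation.Nullary.Decidable using (⌊_⌋)
open import Relation.Binary.PropositionalEquality using (_≡_; _≢_)
open import Function.Definitions using (Injective)
open import Algebra.Bundles using (CommutativeRing)

record IsField {c ℓ : Level} (R : CommutativeRing c ℓ) : Set (c ⊔ ℓ) where
  open CommutativeRing R
  field
    1≉0     : ¬ (1# ≈ 0#)
    inverse : ∀ x → ¬ (x ≈ 0#) → Σ Carrier (λ y → x * y ≈ 1#)

CharNot2 : {c ℓ : Level} (R : CommutativeRing c ℓ) → Set ℓ
CharNot2 R = ¬ (1# + 1# ≈ 0#) where open CommutativeRing R

Point : Set
Point = Fin 7

record FanoPlane : Set where
  field
    line          : Fin 7 → Subset 7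
    line-size     : ∀ L → ∣ line L ∣ ≡ 3
    lines-distinct : Injective _≡_ _≡_ line
    two-points    : ∀ P Q → P ≢ Q →
                    ∃! _≡_ (λ L → P ∈ line L × Q ∈ line L)
    two-lines     : ∀ L M → L ≢ M →
                    ∃! _≡_ (λ P → P ∈ line L × P ∈ line M)

findFin : ∀ {n} → (Fin n → Bool) → Maybe (Fin n)
findFin {zero}  p = nothing
findFin {suc n} p with p zero
... | true  = just zero
... | false with findFin {n} (λ i → p (suc i))
...   | just i  = just (suc i)
...   | nothing = nothing

_≠ᵇ_ : Point → Point → Bool
P ≠ᵇ Q = not ⌊ P ≟ Q ⌋

-- the third point of the line through two distinct points P, Q
-- (the fallback value P is never used when P ≢ Q, by the axioms)
third : FanoPlane → Point → Point → Point
third F P Q with findFin (λ L → lookup (line L) P ∧ lookup (line L) Q)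
  where open FanoPlane F
... | nothing = P
... | just L with findFin (λ R → lookup (FanoPlane.line F L) R ∧ (R ≠ᵇ P) ∧ (R ≠ᵇ Q))
...   | nothing = P
...   | just R  = R

-- The Fano cube V_F = F ∪ {0}; nothing plays the role of 0.
V : Set
V = Maybe Point

addV : FanoPlane → V → V → V
addV F nothing  y        = y
addV F (just P) nothing  = just P
addV F (just P) (just Q) with P ≟ Q
... | yes _ = nothing
... | no  _ = just (third F P Q)

-- Multiplication factors.  Values ±1 are encoded as Bool
-- (true = +1, false = -1); the diagonal values are irrelevant.

record MultFactor : Set where
  field
    ε    : Point → Point → Bool
    anti : ∀ P Q → P ≢ Q → ε Q P ≡ not (ε P Q)

future : MultFactor → Point → Subset 7
future e P = tabulate (λ Q → (Q ≠ᵇ P) ∧ MultFactor.ε e P Q)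

past : MultFactor → Point → Subset 7
past e P = tabulate (λ Q → (Q ≠ᵇ P) ∧ not (MultFactor.ε e P Q))

IsLine : FanoPlane → Subset 7 → Set
IsLine F S = ∃ λ L → S ≡ FanoPlane.line F L

allV : List V
allV = nothing ∷ map just (tabulateList)
  where
  tabulateList : List Point
  tabulateList = Data.List.tabulate (λ i → i)
    where import Data.List

-- e_P ·_ε e_Q = sign P Q · e_{target P Q}  (sign: true = +1, false = -1)
baseSign : MultFactor → V → V → Bool
baseSign e nothing  _        = true
baseSign e (just P) nothing  = true
baseSign e (just P) (just Q) with P ≟ Q
... | yes _ = false
... | no  _ = MultFactor.ε e P Q

module Algebra {c ℓ : Level} (R : CommutativeRing c ℓ) where
  open CommutativeRing R

  O : Set c
  O = V → Carrier

  Σᵥ : (V → Carrier) → Carrier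
  Σᵥ f = foldr (λ x acc → f x + acc) 0# allV

  signVal : Bool → Carrier
  signVal true  = 1#
  signVal false = - 1#

  baseCoeff : FanoPlane → MultFactor → V → V → V → Carrier
  baseCoeff F e P Q R with Data.Maybe.Properties.≡-dec _≟_ (addV F P Q) R
    where import Data.Maybe.Properties
  ... | yes _ = signVal (baseSign e P Q)
  ... | no  _ = 0#

  mul : FanoPlane → MultFactor → O → O → O
  mul F e Z W R = Σᵥ (λ P → Σᵥ (λ Q → (Z P * W Q) * baseCoeff F e P Q R))

  N : O → Carrier
  N Z = Σᵥ (λ P → Z P * Z P)

  IsCompositionAlgebra : FanoPlane → MultFactor → Set (c ⊔ ℓ)
  IsCompositionAlgebra F e = ∀ Z W → N (mul F e Z W) ≈ N Z * N W

{-# OPTIONS --safe #-}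
-- Write e_P e_Q = s(P,Q) e_{P+Q}.  Expanding N(ZW) and symmetrising in the two
-- W-indices, the norm is multiplicative as soon as, whenever P ≠ P' and
-- P + Q = P' + Q', also P + Q' = P' + Q and s(P,Q) s(P',Q') = - s(P,Q') s(P',Q).
-- The sign rule comes from the fact that a line meets every line in one or three
-- points: if the futures are lines, then ε_P has product +1 over each line
-- missing P, and takes opposite values on the other two points of a line
-- through P.  Every sign product involved has even degree, so replacing ε by -ε
-- exchanges futures and pasts without affecting the argument.
module Submission where

open import Defs
open import Level using (Level)
open import Data.Sum using (_⊎_; inj₁; inj₂)
open import Algebra.Bundles using (CommutativeRing)
import Algebra.Properties.Ring as RingProperties
import Algebra.Properties.Semiring.Sum as SemiringSum
import Algebra.Solver.CommutativeMonoid as CommutativeMonoidSolver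
import Relation.Binary.Reasoning.Setoid as SetoidReasoning
open import Data.Nat using (suc; _≤_; _<_; z≤n; s≤s)
import Data.Nat as ℕ
open import Data.Nat.Properties using (≤-trans; ≤-reflexive; <⇒≢; m≤n⇒m≤1+n; +-suc)
open import Data.Bool using (Bool; true; false; not; _∧_; _xor_)
open import Data.Bool.Properties using (not-involutive; xor-comm; xor-same; xor-inverseʳ)
open import Data.Fin using (Fin; zero; suc; _≟_)
open import Data.Fin.Properties using (punchInᵢ≢i)
open import Data.Fin.Subset using (Subset; _∈_; _∉_; _∪_; _-_; ∣_∣; ⁅_⁆)
open import Data.Fin.Subset.Properties using (x∈p∧x≢y⇒x∈p-y; x∈p⇒∣p-x∣<∣p∣; p⊆q⇒∣p∣≤∣q∣; ∣⁅x⁆∣≡1; x∈⁅x⁆; x∈p∪q⁺)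
open import Data.Maybe using (just; nothing)
open import Data.Maybe.Properties using (≡-dec)
open import Data.Product using (∃; _×_; _,_; proj₁)
open import Data.Vec using ([]; _∷_; lookup)
open import Data.Vec.Properties using (lookup⇒[]=; []=⇒lookup; lookup∘tabulate)
open import Function using (_∘_)
open import Relation.Nullary using (yes; no; contradiction)
open import Relation.Binary.PropositionalEquality using (_≡_; _≢_; refl; sym; trans; cong; cong₂; subst; ≢-sym; module ≡-Reasoning)

-- Boolean search, sizes of finite subsets, and identities for exclusive or.

findFin-just : ∀ {n} (p : Fin n → Bool) {i} → findFin p ≡ just i → p i ≡ true
findFin-just {suc n} p eq with p zero in p0
findFin-just {suc n} p refl | true = p0
... | false with findFin (p ∘ suc) in tl
findFin-just {suc n} p refl | false | just i = findFin-just (p ∘ suc) tl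

findFin-nothing : ∀ {n} (p : Fin n → Bool) → findFin p ≡ nothing → ∀ i → p i ≡ false
findFin-nothing {suc n} p eq i with p zero in p0
... | false with findFin (p ∘ suc) in tl
findFin-nothing {suc n} p eq zero | false | nothing = p0
findFin-nothing {suc n} p eq (suc i) | false | nothing = findFin-nothing (p ∘ suc) tl i

∧-true : ∀ a b → a ∧ b ≡ true → a ≡ true × b ≡ true
∧-true true true refl = refl , refl

≠ᵇ-true : ∀ {P Q} → P ≢ Q → (P ≠ᵇ Q) ≡ true
≠ᵇ-true {P} {Q} P≢Q with P ≟ Q
... | yes eq = contradiction eq P≢Q
... | no  _  = refl

≠ᵇ-irrefl : ∀ P → (P ≠ᵇ P) ≡ false
≠ᵇ-irrefl P with P ≟ P
... | yes _ = refl
... | no  ≢ = contradiction refl ≢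

≠ᵇ⇒≢ : ∀ {P Q} → (P ≠ᵇ Q) ≡ true → P ≢ Q
≠ᵇ⇒≢ {P} eq refl with () ← trans (sym (≠ᵇ-irrefl P)) eq

∉⇒lookup : ∀ {n} {S : Subset n} {x} → x ∉ S → lookup S x ≡ false
∉⇒lookup {S = S} {x} x∉S with lookup S x in eq
... | true  = contradiction (lookup⇒[]= x S eq) x∉S
... | false = refl

∣p∪q∣≤∣p∣+∣q∣ : ∀ {n} (p q : Subset n) → ∣ p ∪ q ∣ ≤ ∣ p ∣ ℕ.+ ∣ q ∣
∣p∪q∣≤∣p∣+∣q∣ [] [] = z≤n
∣p∪q∣≤∣p∣+∣q∣ (false ∷ p) (false ∷ q) = ∣p∪q∣≤∣p∣+∣q∣ p q
∣p∪q∣≤∣p∣+∣q∣ (false ∷ p) (true ∷ q) =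
  ≤-trans (s≤s (∣p∪q∣≤∣p∣+∣q∣ p q)) (≤-reflexive (sym (+-suc ∣ p ∣ ∣ q ∣)))
∣p∪q∣≤∣p∣+∣q∣ (true ∷ p) (false ∷ q) = s≤s (∣p∪q∣≤∣p∣+∣q∣ p q)
∣p∪q∣≤∣p∣+∣q∣ (true ∷ p) (true ∷ q) =
  s≤s (≤-trans (m≤n⇒m≤1+n (∣p∪q∣≤∣p∣+∣q∣ p q)) (≤-reflexive (sym (+-suc ∣ p ∣ ∣ q ∣))))

p⊆pair⇒∣p∣≤2 : ∀ {n} {p : Subset n} {a b} → (∀ {x} → x ∈ p → x ≡ a ⊎ x ≡ b) → ∣ p ∣ ≤ 2
p⊆pair⇒∣p∣≤2 {p = p} {a} {b} p⊆ab = ≤-trans (p⊆q⇒∣p∣≤∣q∣ p⊆) (≤-trans (∣p∪q∣≤∣p∣+∣q∣ ⁅ a ⁆ ⁅ b ⁆)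
  (≤-reflexive (cong₂ ℕ._+_ (∣⁅x⁆∣≡1 a) (∣⁅x⁆∣≡1 b))))
  where
  p⊆ : ∀ {x} → x ∈ p → x ∈ ⁅ a ⁆ ∪ ⁅ b ⁆
  p⊆ x∈p with p⊆ab x∈p
  ... | inj₁ refl = x∈p∪q⁺ (inj₁ (x∈⁅x⁆ _))
  ... | inj₂ refl = x∈p∪q⁺ (inj₂ (x∈⁅x⁆ _))

-- Each of the four points is still present when its turn to be removed comes, and each removal
-- strictly lowers the size.
four-points⇒3<∣p∣ : ∀ {n} {p : Subset n} {a b c d} → a ∈ p → b ∈ p → c ∈ p → d ∈ p →
                    a ≢ b → a ≢ c → a ≢ d → b ≢ c → b ≢ d → c ≢ d → 3 < ∣ p ∣
four-points⇒3<∣p∣ a∈ b∈ c∈ d∈ a≢b a≢c a≢d b≢c b≢d c≢d =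
  remove a∈ (remove (x∈p∧x≢y⇒x∈p-y b∈ (≢-sym a≢b))
    (remove (x∈p∧x≢y⇒x∈p-y (x∈p∧x≢y⇒x∈p-y c∈ (≢-sym a≢c)) (≢-sym b≢c))
      (remove (x∈p∧x≢y⇒x∈p-y (x∈p∧x≢y⇒x∈p-y (x∈p∧x≢y⇒x∈p-y d∈ (≢-sym a≢d)) (≢-sym b≢d)) (≢-sym c≢d)) z≤n)))
  where
  remove : ∀ {n m} {p : Subset n} {x} → x ∈ p → m ≤ ∣ p - x ∣ → m < ∣ p ∣
  remove x∈p m≤ = ≤-trans (s≤s m≤) (x∈p⇒∣p-x∣<∣p∣ x∈p)

not-xor-not : ∀ a b → not a xor not b ≡ a xor b
not-xor-not true  true  = refl
not-xor-not true  false = refl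
not-xor-not false true  = refl
not-xor-not false false = refl

xor-odd₂ : ∀ {x y z} → x ≡ false → x xor (y xor z) ≡ true → z ≡ not y
xor-odd₂ {y = true}  {false} refl refl = refl
xor-odd₂ {y = false} {true}  refl refl = refl

xor-odd₃ : ∀ x y {z} → x xor (y xor z) ≡ true → x xor y ≡ not z
xor-odd₃ true  true  {true}  refl = refl
xor-odd₃ true  false {false} refl = refl
xor-odd₃ false true  {false} refl = refl
xor-odd₃ false false {true}  refl = refl

-- `future (opposite e) P` is definitionally `past e P`, so results about futures apply to pasts
-- without any transport.
opposite : MultFactor → MultFactor
opposite e = record { ε = λ P Q → not (ε P Q) ; anti = λ P Q P≢Q → cong not (anti P Q P≢Q) }
  where open MultFactor e

-- Incidence geometry of the Fano plane.

module _ (F : FanoPlane) where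
  open FanoPlane F

  -- The relational form of p + q = r for distinct points p and q. Unlike an equation about `third`,
  -- it is visibly invariant under permutations of the three points.
  record Collinear (p q r : Point) : Set where
    field
      p≢q : p ≢ q
      p≢r : p ≢ r
      q≢r : q ≢ r
      ℓ   : Fin 7
      p∈ℓ : p ∈ line ℓ
      q∈ℓ : q ∈ line ℓ
      r∈ℓ : r ∈ line ℓ

  collinear-swap₁₂ : ∀ {p q r} → Collinear p q r → Collinear q p r
  collinear-swap₁₂ c = record
    { p≢q = ≢-sym p≢q ; p≢r = q≢r ; q≢r = p≢r ; ℓ = ℓ ; p∈ℓ = q∈ℓ ; q∈ℓ = p∈ℓ ; r∈ℓ = r∈ℓ }
    where open Collinear c

  collinear-swap₂₃ : ∀ {p q r} → Collinear p q r → Collinear p r q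
  collinear-swap₂₃ c = record
    { p≢q = p≢r ; p≢r = p≢q ; q≢r = ≢-sym q≢r ; ℓ = ℓ ; p∈ℓ = p∈ℓ ; q∈ℓ = r∈ℓ ; r∈ℓ = q∈ℓ }
    where open Collinear c

  line-unique : ∀ {p q L M} → p ≢ q → p ∈ line L → q ∈ line L → p ∈ line M → q ∈ line M → L ≡ M
  line-unique p≢q p∈L q∈L p∈M q∈M with _ , _ , unique ← two-points _ _ p≢q =
    trans (sym (unique (p∈L , q∈L))) (unique (p∈M , q∈M))

  -- Two points determine the line, so L also contains r; adding x would give it a fourth point.
  off-line : ∀ {p q r x L} → Collinear p q r → x ≢ p → x ≢ q → x ≢ r →
             p ∈ line L → q ∈ line L → x ∉ line L
  off-line {L = L} c x≢p x≢q x≢r p∈L q∈L x∈L =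
    <⇒≢ (four-points⇒3<∣p∣ x∈L p∈L q∈L
          (subst (λ M → _ ∈ line M) (line-unique p≢q p∈ℓ q∈ℓ p∈L q∈L) r∈ℓ)
          x≢p x≢q x≢r p≢q p≢r q≢r)
        (sym (line-size L))
    where open Collinear c

  on-line : ∀ {p q r x} (c : Collinear p q r) → x ∈ line (Collinear.ℓ c) → x ≡ p ⊎ x ≡ q ⊎ x ≡ r
  on-line {p} {q} {r} {x} c x∈ℓ with x ≟ p | x ≟ q | x ≟ r
  ... | yes x≡p | _       | _       = inj₁ x≡p
  ... | no  _   | yes x≡q | _       = inj₂ (inj₁ x≡q)
  ... | no  _   | no  _   | yes x≡r = inj₂ (inj₂ x≡r)
  ... | no  x≢p | no  x≢q | no  x≢r = contradiction x∈ℓ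
    (off-line c x≢p x≢q x≢r (Collinear.p∈ℓ c) (Collinear.q∈ℓ c))

  collinear-unique : ∀ {p q r r′} → Collinear p q r → Collinear p q r′ → r ≡ r′
  collinear-unique {r = r} {r′} c c′ with r ≟ r′
  ... | yes r≡r′ = r≡r′
  ... | no  r≢r′ = contradiction (Collinear.r∈ℓ c) (off-line c′ (≢-sym (Collinear.p≢r c))
    (≢-sym (Collinear.q≢r c)) r≢r′ (Collinear.p∈ℓ c) (Collinear.q∈ℓ c))

  through : Point → Point → Fin 7 → Bool
  through p q L = lookup (line L) p ∧ lookup (line L) q

  third-on : Fin 7 → Point → Point → Point → Bool
  third-on L p q R = lookup (line L) R ∧ (R ≠ᵇ p) ∧ (R ≠ᵇ q)

  -- Both fallbacks of `third` are refuted: a failed search for a line contradicts `two-points`, and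
  -- a failed search for a third point would leave a line with at most two points.
  third-collinear : ∀ {p q} → p ≢ q → Collinear p q (third F p q)
  third-collinear {p} {q} p≢q with findFin (through p q) in eqL
  ... | nothing with L , (p∈L , q∈L) , _ ← two-points p q p≢q
                with () ← trans (sym (findFin-nothing (through p q) eqL L))
                            (cong₂ _∧_ ([]=⇒lookup p∈L) ([]=⇒lookup q∈L))
  ... | just L with findFin (third-on L p q) in eqR
  ...   | nothing = contradiction (line-size L) (<⇒≢ (s≤s (p⊆pair⇒∣p∣≤2 in-pair)))
    where
    in-pair : ∀ {x} → x ∈ line L → x ≡ p ⊎ x ≡ q
    in-pair {x} x∈L with x ≟ p | x ≟ q
    ... | yes x≡p | _       = inj₁ x≡p
    ... | no  _   | yes x≡q = inj₂ x≡q
    ... | no  x≢p | no  x≢q with () ← trans (sym (findFin-nothing (third-on L p q) eqR x))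
      (cong₂ _∧_ ([]=⇒lookup x∈L) (cong₂ _∧_ (≠ᵇ-true x≢p) (≠ᵇ-true x≢q)))
  ...   | just R
    with p∈L , q∈L ← ∧-true _ _ (findFin-just (through p q) eqL)
       | R∈L , R≢pq ← ∧-true _ _ (findFin-just (third-on L p q) eqR)
    with R≢p , R≢q ← ∧-true _ _ R≢pq = record
    { p≢q = p≢q
    ; p≢r = ≢-sym (≠ᵇ⇒≢ R≢p)
    ; q≢r = ≢-sym (≠ᵇ⇒≢ R≢q)
    ; ℓ   = L
    ; p∈ℓ = lookup⇒[]= _ _ p∈L
    ; q∈ℓ = lookup⇒[]= _ _ q∈L
    ; r∈ℓ = lookup⇒[]= _ _ R∈L
    }

  -- The lines pq′ and p′q meet, and their common point is none of p, q, p′, q′.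
  exchange : ∀ {p q p′ q′ r} → Collinear p q r → Collinear p′ q′ r → p ≢ p′ → p ≢ q′ → q ≢ p′ → q ≢ q′ →
             ∃ λ x → Collinear p q′ x × Collinear p′ q x
  exchange {p} {q} {p′} {q′} {r} c c′ p≢p′ p≢q′ q≢p′ q≢q′
    with A , (p∈A , q′∈A) , _ ← two-points p q′ p≢q′
       | B , (p′∈B , q∈B) , _ ← two-points p′ q (≢-sym q≢p′)
    -- If A and B coincided, p′ would lie on the line pq, although it differs from p, q and r.
    with A≢B ← (λ { refl → off-line c (≢-sym p≢p′) (≢-sym q≢p′) (Collinear.p≢r c′) p∈A q∈B p′∈B })
    with x , (x∈A , x∈B) , _ ← two-lines A B A≢B =
    x , record { p≢q = p≢q′ ; p≢r = p≢x ; q≢r = q′≢x ; ℓ = A ; p∈ℓ = p∈A ; q∈ℓ = q′∈A ; r∈ℓ = x∈A }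
      , record { p≢q = ≢-sym q≢p′ ; p≢r = p′≢x ; q≢r = q≢x ; ℓ = B ; p∈ℓ = p′∈B ; q∈ℓ = q∈B ; r∈ℓ = x∈B }
    where
    p≢x : p ≢ x
    -- As in the three cases below, a coincidence with x would put three of p, q, p′, q′ on A or on
    -- B, but no three of these points are collinear.
    p≢x refl = off-line c (≢-sym p≢p′) (≢-sym q≢p′) (Collinear.p≢r c′) x∈B q∈B p′∈B
    q′≢x : q′ ≢ x
    q′≢x refl = off-line c′ q≢p′ q≢q′ (Collinear.q≢r c) p′∈B x∈B q∈B
    p′≢x : p′ ≢ x
    p′≢x refl = off-line c′ p≢p′ p≢q′ (Collinear.p≢r c) x∈A q′∈A p∈A
    q≢x : q ≢ x
    q≢x refl = off-line c (≢-sym p≢q′) (≢-sym q≢q′) (Collinear.q≢r c′) p∈A x∈A q′∈A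

  -- Equal lines share three points and distinct lines share exactly one; both counts are odd.
  line-parity : ∀ {p q r} → Collinear p q r → ∀ L →
                lookup (line L) p xor (lookup (line L) q xor lookup (line L) r) ≡ true
  line-parity {p} {q} {r} c L with Collinear.ℓ c ≟ L
  ... | yes refl = cong₂ _xor_ ([]=⇒lookup (Collinear.p∈ℓ c))
                     (cong₂ _xor_ ([]=⇒lookup (Collinear.q∈ℓ c)) ([]=⇒lookup (Collinear.r∈ℓ c)))
  ... | no ℓ≢L with x , (x∈ℓ , x∈L) , unique ← two-lines _ L ℓ≢L
               with on-line c x∈ℓ
  ...   | inj₁ refl = cong₂ _xor_ ([]=⇒lookup x∈L) (cong₂ _xor_
            (∉⇒lookup λ q∈L → Collinear.p≢q c (unique (Collinear.q∈ℓ c , q∈L)))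
            (∉⇒lookup λ r∈L → Collinear.p≢r c (unique (Collinear.r∈ℓ c , r∈L))))
  ...   | inj₂ (inj₁ refl) = cong₂ _xor_
            (∉⇒lookup λ p∈L → ≢-sym (Collinear.p≢q c) (unique (Collinear.p∈ℓ c , p∈L)))
            (cong₂ _xor_ ([]=⇒lookup x∈L)
            (∉⇒lookup λ r∈L → Collinear.q≢r c (unique (Collinear.r∈ℓ c , r∈L))))
  ...   | inj₂ (inj₂ refl) = cong₂ _xor_
            (∉⇒lookup λ p∈L → ≢-sym (Collinear.p≢r c) (unique (Collinear.p∈ℓ c , p∈L)))
            (cong₂ _xor_
            (∉⇒lookup λ q∈L → ≢-sym (Collinear.q≢r c) (unique (Collinear.q∈ℓ c , q∈L)))
            ([]=⇒lookup x∈L))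

  -- Sign rules for a multiplication factor.

  -- All that the later argument uses of the futures or pasts being lines. As `true` encodes +1, an
  -- exclusive or is true exactly when the product of the two signs is -1. In `on-quadrangle`, r is
  -- a diagonal point of the quadrangle p, p′, q, q′, and the rule makes the product of the four
  -- signs joining {p, p′} to {q, q′} equal to -1.
  record Alternating (ε : Point → Point → Bool) : Set where
    field
      on-lines      : ∀ {p q r} → Collinear p q r → ε p r ≡ not (ε p q)
      on-quadrangle : ∀ {p p′ q q′ r} → Collinear p p′ r → Collinear q q′ r →
                      p ≢ q → p ≢ q′ → p′ ≢ q → p′ ≢ q′ →
                      ε p q xor ε p q′ ≡ not (ε p′ q xor ε p′ q′)

  -- The first rule involves two signs and the second four, so negating every sign changes neither.
  alternating-not : ∀ {ε} → Alternating (λ p q → not (ε p q)) → Alternating ε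
  alternating-not {ε} alt = record
    { on-lines = λ {p} {q} {r} c →
        trans (sym (not-involutive (ε p r))) (cong not (trans (on-lines c) (not-involutive (ε p q))))
    ; on-quadrangle = λ {p} {p′} {q} {q′} c c′ n₁ n₂ n₃ n₄ →
        trans (sym (not-xor-not (ε p q) (ε p q′)))
          (trans (on-quadrangle c c′ n₁ n₂ n₃ n₄) (cong not (not-xor-not (ε p′ q) (ε p′ q′))))
    }
    where open Alternating alt

  module _ (e : MultFactor) where
    open MultFactor e

    lookup-future : ∀ {p q} → p ≢ q → lookup (future e p) q ≡ ε p q
    lookup-future {p} {q} p≢q = trans (lookup∘tabulate (λ Q → (Q ≠ᵇ p) ∧ ε p Q) q) (cong (_∧ ε p q) (≠ᵇ-true (≢-sym p≢q)))

    lookup-future-self : ∀ p → lookup (future e p) p ≡ false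
    lookup-future-self p = trans (lookup∘tabulate (λ Q → (Q ≠ᵇ p) ∧ ε p Q) p) (cong (_∧ ε p p) (≠ᵇ-irrefl p))

    module _ (future-line : ∀ P → IsLine F (future e P)) where

      future-parity : ∀ p {a b c} → Collinear a b c →
        lookup (future e p) a xor (lookup (future e p) b xor lookup (future e p) c) ≡ true
      future-parity p c with L , eq ← future-line p rewrite eq = line-parity c L

      -- Since p is not in its own future, parity leaves exactly one of q and r in it.
      future-on-lines : ∀ {p q r} → Collinear p q r → ε p r ≡ not (ε p q)
      future-on-lines {p} {q} {r} c = begin
        ε p r                       ≡⟨ lookup-future p≢r ⟨
        lookup (future e p) r       ≡⟨ xor-odd₂ (lookup-future-self p) (future-parity p c) ⟩
        not (lookup (future e p) q) ≡⟨ cong not (lookup-future p≢q) ⟩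
        not (ε p q)                 ∎
        where open ≡-Reasoning
              open Collinear c

      -- An odd number of the points q, q′, r lies in the future of p, so the product of the three
      -- signs is +1.
      future-off-lines : ∀ {p q q′ r} → Collinear q q′ r → p ≢ q → p ≢ q′ → p ≢ r →
                         ε p q xor ε p q′ ≡ not (ε p r)
      future-off-lines {p} {q} {q′} {r} c p≢q p≢q′ p≢r = xor-odd₃ (ε p q) (ε p q′) (begin
        ε p q xor (ε p q′ xor ε p r)
          ≡⟨ cong₂ _xor_ (lookup-future p≢q) (cong₂ _xor_ (lookup-future p≢q′) (lookup-future p≢r)) ⟨
        lookup (future e p) q xor (lookup (future e p) q′ xor lookup (future e p) r)
          ≡⟨ future-parity p c ⟩
        true ∎)
        where open ≡-Reasoning

      -- The line q q′ r reduces the two signs at p to the single sign of p and r, and likewise at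
      -- p′. Reversed, these become the values of r at p and p′, which are opposite because r, p, p′
      -- form a line.
      future⇒alternating : Alternating ε
      future⇒alternating = record
        { on-lines      = future-on-lines
        ; on-quadrangle = λ {p} {p′} {q} {q′} {r} c c′ n₁ n₂ n₃ n₄ → begin
            ε p q xor ε p q′         ≡⟨ future-off-lines c′ n₁ n₂ (Collinear.p≢r c) ⟩
            not (ε p r)              ≡⟨ anti p r (Collinear.p≢r c) ⟨
            ε r p                    ≡⟨ future-on-lines (collinear-swap₁₂ (collinear-swap₂₃ (collinear-swap₁₂ c))) ⟩
            not (ε r p′)             ≡⟨ cong not (anti p′ r (Collinear.q≢r c)) ⟩
            not (not (ε p′ r))       ≡⟨ cong not (future-off-lines c′ n₃ n₄ (Collinear.q≢r c)) ⟨
            not (ε p′ q xor ε p′ q′) ∎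
        }
        where open ≡-Reasoning

  lines⇒alternating : ∀ e → (∀ P → IsLine F (future e P)) ⊎ (∀ P → IsLine F (past e P)) →
                      Alternating (MultFactor.ε e)
  lines⇒alternating e (inj₁ future-line) = future⇒alternating e future-line
  lines⇒alternating e (inj₂ past-line)   = alternating-not (future⇒alternating (opposite e) past-line)

  -- The signed multiplication table and the exchange of its factors.

  module _ (e : MultFactor) where
    open MultFactor e

    -- BasisProduct P Q R s is the graph of e_P e_Q = s e_R.
    data BasisProduct : V → V → V → Bool → Set where
      unitˡ    : ∀ {Q} → BasisProduct nothing Q Q true
      unitʳ    : ∀ {p} → BasisProduct (just p) nothing (just p) true
      square   : ∀ {p} → BasisProduct (just p) (just p) nothing false
      distinct : ∀ {p q r} → Collinear p q r → BasisProduct (just p) (just q) (just r) (ε p q)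

    basisProduct : ∀ P Q → BasisProduct P Q (addV F P Q) (baseSign e P Q)
    basisProduct nothing  Q        = unitˡ
    basisProduct (just p) nothing  = unitʳ
    basisProduct (just p) (just q) with p ≟ q
    ... | yes refl = square
    ... | no  p≢q  = distinct (third-collinear p≢q)

    basisProduct-unique : ∀ {P Q R R′ s s′} → BasisProduct P Q R s → BasisProduct P Q R′ s′ →
                          R ≡ R′ × s ≡ s′
    basisProduct-unique unitˡ        unitˡ         = refl , refl
    basisProduct-unique unitʳ        unitʳ         = refl , refl
    basisProduct-unique square       square        = refl , refl
    basisProduct-unique square       (distinct c)  = contradiction refl (Collinear.p≢q c)
    basisProduct-unique (distinct c) square        = contradiction refl (Collinear.p≢q c)
    basisProduct-unique (distinct c) (distinct c′) = cong just (collinear-unique c c′) , refl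

    basisProduct-cancelˡ : ∀ {P Q Q′ R s s′} → BasisProduct P Q R s → BasisProduct P Q′ R s′ → Q ≡ Q′
    basisProduct-cancelˡ unitˡ        unitˡ         = refl
    basisProduct-cancelˡ unitʳ        unitʳ         = refl
    basisProduct-cancelˡ unitʳ        (distinct c)  = contradiction refl (Collinear.p≢r c)
    basisProduct-cancelˡ square       square        = refl
    basisProduct-cancelˡ (distinct c) unitʳ         = contradiction refl (Collinear.p≢r c)
    basisProduct-cancelˡ (distinct c) (distinct c′) =
      cong just (collinear-unique (collinear-swap₂₃ c) (collinear-swap₂₃ c′))

    -- The last component reads s s′ = - t t′: the contributions of the original and the crossed
    -- pair of products to the norm will cancel.
    Crossed : V → V → V → V → Bool → Bool → Set
    Crossed P Q P′ Q′ s s′ = ∃ λ R → ∃ λ t → ∃ λ t′ →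
      BasisProduct P Q′ R t × BasisProduct P′ Q R t′ × s xor s′ ≡ not (t xor t′)

    crossed-sym : ∀ {P Q P′ Q′} s s′ → Crossed P′ Q′ P Q s′ s → Crossed P Q P′ Q′ s s′
    crossed-sym s s′ (R , t , t′ , b , b′ , eq) =
      R , t′ , t , b′ , b , trans (xor-comm s s′) (trans eq (cong not (xor-comm t t′)))

    module _ (alt : Alternating ε) where
      open Alternating alt

      ε-anti-xor : ∀ {p q} → p ≢ q → ε p q xor ε q p ≡ true
      ε-anti-xor {p} {q} p≢q = trans (cong (ε p q xor_) (anti p q p≢q)) (xor-inverseʳ (ε p q))

      collinear-crossed : ∀ {p q p′ q′ r} → Collinear p q r → Collinear p′ q′ r → p ≢ p′ →
        Crossed (just p) (just q) (just p′) (just q′) (ε p q) (ε p′ q′)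
      collinear-crossed {p} {q} {p′} {q′} c c′ p≢p′ with p ≟ q′
      -- Here q equals p′ too, both being the third point on the line through p and r. The crossed
      -- products are squares, each equal to -e_0, and anticommutativity supplies the sign.
      ... | yes refl with refl ← collinear-unique (collinear-swap₂₃ c)
                                   (collinear-swap₂₃ (collinear-swap₁₂ c′)) =
        nothing , false , false , square , square , ε-anti-xor p≢p′
      ... | no p≢q′ = crossed
        where
        q≢q′ : q ≢ q′
        q≢q′ refl = p≢p′ (collinear-unique (collinear-swap₂₃ (collinear-swap₁₂ c))
                                           (collinear-swap₂₃ (collinear-swap₁₂ c′)))
        q≢p′ : q ≢ p′
        q≢p′ refl = p≢q′ (collinear-unique (collinear-swap₂₃ (collinear-swap₁₂ c))
                                           (collinear-swap₂₃ c′))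
        -- Both equations say that the exclusive or of all four values is true, a condition
        -- symmetric in them.
        transpose : ∀ {w x y z} → w xor x ≡ not (y xor z) → w xor z ≡ not (x xor y)
        transpose {true}  {true}  {true}  {false} refl = refl
        transpose {true}  {true}  {false} {true}  refl = refl
        transpose {true}  {false} {true}  {true}  refl = refl
        transpose {true}  {false} {false} {false} refl = refl
        transpose {false} {true}  {true}  {true}  refl = refl
        transpose {false} {true}  {false} {false} refl = refl
        transpose {false} {false} {true}  {false} refl = refl
        transpose {false} {false} {false} {true}  refl = refl
        crossed : Crossed (just p) (just q) (just p′) (just q′) (ε p q) (ε p′ q′)
        crossed
          -- Two diagonal points are needed: x, where pq′ meets p′q, is the common target of the
          -- crossed products, while y, where pp′ meets qq′, is the one required by `on-quadrangle`.
          with x , pq′x , p′qx ← exchange c c′ p≢p′ p≢q′ q≢p′ q≢q′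
             | y , pp′y , q′qy ← exchange c (collinear-swap₁₂ c′) p≢q′ p≢p′ q≢q′ q≢p′ =
          just x , ε p q′ , ε p′ q , distinct pq′x , distinct p′qx ,
          transpose {ε p q} {ε p q′} (on-quadrangle pp′y (collinear-swap₁₂ q′qy)
            (Collinear.p≢q c) p≢q′ (≢-sym q≢p′) (Collinear.p≢q c′))

      -- The case of three collinear points amounts to e_p (e_p e_q) = - e_q, which is `on-lines` at
      -- p.
      unitˡ-crossed : ∀ {P′ Q′ R s′} → nothing ≢ P′ → BasisProduct P′ Q′ R s′ →
                      Crossed nothing R P′ Q′ true s′
      unitˡ-crossed 0≢P′ unitˡ  = contradiction refl 0≢P′
      unitˡ-crossed 0≢P′ unitʳ  = nothing , true , false , unitˡ , square , refl
      unitˡ-crossed 0≢P′ square = _ , true , true , unitˡ , unitʳ , refl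
      unitˡ-crossed 0≢P′ (distinct {p} {q} {r} c) =
        _ , true , ε p r , unitˡ , distinct (collinear-swap₂₃ c) ,
        trans (sym (on-lines c)) (sym (not-involutive (ε p r)))

      -- The mirror image for right multiplication by e_q: anticommutativity reduces it to
      -- `on-lines` at q.
      unitʳ-crossed : ∀ {p q r} → Collinear p q r →
                      Crossed (just r) nothing (just p) (just q) true (ε p q)
      unitʳ-crossed {p} {q} {r} c =
        _ , ε r q , true , distinct (collinear-swap₁₂ (collinear-swap₂₃ (collinear-swap₁₂ c))) , unitʳ ,
        cong not (begin
          ε p q           ≡⟨ anti q p (≢-sym (Collinear.p≢q c)) ⟩
          not (ε q p)     ≡⟨ on-lines (collinear-swap₁₂ c) ⟨
          ε q r           ≡⟨ anti r q (≢-sym (Collinear.q≢r c)) ⟩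
          not (ε r q)     ≡⟨ xor-comm true (ε r q) ⟩
          ε r q xor true  ∎)
        where open ≡-Reasoning

      basisProduct-crossed : ∀ {P Q P′ Q′ R s s′} → P ≢ P′ →
        BasisProduct P Q R s → BasisProduct P′ Q′ R s′ → Crossed P Q P′ Q′ s s′
      basisProduct-crossed P≢P′ unitˡ b = unitˡ-crossed P≢P′ b
      basisProduct-crossed P≢P′ b@unitʳ unitˡ = crossed-sym true true (unitˡ-crossed (≢-sym P≢P′) b)
      basisProduct-crossed P≢P′ unitʳ unitʳ = contradiction refl P≢P′
      basisProduct-crossed P≢P′ unitʳ (distinct c) = unitʳ-crossed c
      basisProduct-crossed P≢P′ b@square unitˡ = crossed-sym false true (unitˡ-crossed (≢-sym P≢P′) b)
      -- Both squares are -e_0, and the crossed products are those of the same two points in the two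
      -- orders, hence opposite.
      basisProduct-crossed P≢P′ square square with third-collinear (λ eq → P≢P′ (cong just eq))
      ... | c = _ , _ , _ , distinct c , distinct (collinear-swap₁₂ c) ,
                sym (cong not (ε-anti-xor (Collinear.p≢q c)))
      basisProduct-crossed P≢P′ b@(distinct {p} {q} _) unitˡ =
        crossed-sym (ε p q) true (unitˡ-crossed (≢-sym P≢P′) b)
      basisProduct-crossed P≢P′ (distinct {p} {q} c) unitʳ = crossed-sym (ε p q) true (unitʳ-crossed c)
      basisProduct-crossed P≢P′ (distinct c) (distinct c′) =
        collinear-crossed c c′ (λ eq → P≢P′ (cong just eq))

      addV-crossed : ∀ {P Q P′ Q′} → P ≢ P′ → addV F P Q ≡ addV F P′ Q′ →
        addV F P Q′ ≡ addV F P′ Q ×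
        baseSign e P Q xor baseSign e P′ Q′ ≡ not (baseSign e P Q′ xor baseSign e P′ Q)
      addV-crossed {P} {Q} {P′} {Q′} P≢P′ eq
        with R , t , t′ , b , b′ , signs ← basisProduct-crossed P≢P′ (basisProduct P Q)
               (subst (λ R → BasisProduct P′ Q′ R _) (sym eq) (basisProduct P′ Q′))
        with refl , refl ← basisProduct-unique (basisProduct P Q′) b
           | eq′ , refl ← basisProduct-unique (basisProduct P′ Q) b′ = sym eq′ , signs

    addV-cancelˡ : ∀ {P Q Q′} → addV F P Q ≡ addV F P Q′ → Q ≡ Q′
    addV-cancelˡ {P} {Q} {Q′} eq = basisProduct-cancelˡ (basisProduct P Q)
      (subst (λ R → BasisProduct P Q′ R _) (sym eq) (basisProduct P Q′))

-- Sums over the Fano cube and signs as ring elements.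

module Composition {c ℓ : Level} (𝔽 : CommutativeRing c ℓ) where
  open CommutativeRing 𝔽 hiding (zero; _-_) renaming (refl to ≈-refl; sym to ≈-sym; trans to ≈-trans; reflexive to ≈-reflexive)
  open Algebra 𝔽
  open RingProperties ring using (-‿distribˡ-*; -‿involutive)
  open SemiringSum semiring using (sum-cong-≋; sum-replicate-zero; sum-remove; ∑-distrib-+; ∑-comm; *-distribˡ-sum; *-distribʳ-sum)
  open SetoidReasoning setoid
  open CommutativeMonoidSolver *-commutativeMonoid using (solve; _⊕_; _⊜_)

  -- This follows the order of `allV`, so `Σᵥ f` is definitionally the indexed sum of
  -- `f ∘ fromIndex`.
  fromIndex : Fin 8 → V
  fromIndex zero    = nothing
  fromIndex (suc i) = just i

  fromIndex-injective : ∀ {i j} → fromIndex i ≡ fromIndex j → i ≡ j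
  fromIndex-injective {zero}  {zero}  refl = refl
  fromIndex-injective {suc i} {suc j} refl = refl

  -- Sealing the eight-term sum keeps unification from expanding nested sums.
  opaque
    ∑ᵥ : (V → Carrier) → Carrier
    ∑ᵥ = Σᵥ

    ∑ᵥ-def : ∀ f → Σᵥ f ≡ ∑ᵥ f
    ∑ᵥ-def f = refl

    ∑ᵥ-cong : ∀ {f g} → (∀ P → f P ≈ g P) → ∑ᵥ f ≈ ∑ᵥ g
    ∑ᵥ-cong f≈g = sum-cong-≋ (λ i → f≈g (fromIndex i))

    ∑ᵥ-zero : ∀ {f} → (∀ P → f P ≈ 0#) → ∑ᵥ f ≈ 0#
    ∑ᵥ-zero f≈0 = ≈-trans (∑ᵥ-cong f≈0) (sum-replicate-zero 8)

    ∑ᵥ-+ : ∀ f g → ∑ᵥ (λ P → f P + g P) ≈ ∑ᵥ f + ∑ᵥ g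
    ∑ᵥ-+ f g = ∑-distrib-+ (f ∘ fromIndex) (g ∘ fromIndex)

    ∑ᵥ-comm : ∀ (f : V → V → Carrier) → ∑ᵥ (λ P → ∑ᵥ (f P)) ≈ ∑ᵥ (λ Q → ∑ᵥ (λ P → f P Q))
    ∑ᵥ-comm f = ∑-comm (λ i j → f (fromIndex i) (fromIndex j))

    ∑ᵥ-*ˡ : ∀ x f → x * ∑ᵥ f ≈ ∑ᵥ (λ P → x * f P)
    ∑ᵥ-*ˡ x f = *-distribˡ-sum x (f ∘ fromIndex)

    ∑ᵥ-*ʳ : ∀ x f → ∑ᵥ f * x ≈ ∑ᵥ (λ P → f P * x)
    ∑ᵥ-*ʳ x f = *-distribʳ-sum x (f ∘ fromIndex)

    ∑ᵥ-single : ∀ {f} P → (∀ Q → P ≢ Q → f Q ≈ 0#) → ∑ᵥ f ≈ f P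
    ∑ᵥ-single {f} P zeros = at (index P) (index-inverse P)
      where
      index : V → Fin 8
      index nothing  = zero
      index (just i) = suc i
      index-inverse : ∀ P → fromIndex (index P) ≡ P
      index-inverse nothing  = refl
      index-inverse (just i) = refl
      at : ∀ i → fromIndex i ≡ P → ∑ᵥ f ≈ f P
      at i refl = begin
        ∑ᵥ f          ≈⟨ sum-remove {i = i} (f ∘ fromIndex) ⟩
        f P + _       ≈⟨ +-congˡ (≈-trans (sum-cong-≋ λ j → zeros _ λ eq →
                           punchInᵢ≢i i j (sym (fromIndex-injective eq))) (sum-replicate-zero 7)) ⟩
        f P + 0#      ≈⟨ +-identityʳ _ ⟩
        f P           ∎

  signVal-not : ∀ a → signVal (not a) ≈ - signVal a
  signVal-not true  = ≈-refl
  signVal-not false = ≈-sym (-‿involutive 1#)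

  signVal-* : ∀ a b → signVal a * signVal b ≈ signVal (not (a xor b))
  signVal-* true  b = ≈-trans (*-identityˡ _) (≈-reflexive (cong signVal (sym (not-involutive b))))
  signVal-* false b = begin
    - 1# * signVal b    ≈⟨ -‿distribˡ-* 1# _ ⟨
    - (1# * signVal b)  ≈⟨ -‿cong (*-identityˡ _) ⟩
    - signVal b         ≈⟨ signVal-not b ⟨
    signVal (not b)     ∎

  signVal-cancel : ∀ {a b c d} → a xor b ≡ not (c xor d) →
                   signVal a * signVal b + signVal c * signVal d ≈ 0#
  signVal-cancel {a} {b} {c} {d} eq = begin
    signVal a * signVal b + signVal c * signVal d        ≈⟨ +-cong (signVal-* a b) (signVal-* c d) ⟩
    signVal (not (a xor b)) + signVal (not (c xor d))    ≈⟨ +-cong (signVal-not (a xor b)) (≈-reflexive (cong signVal (sym eq))) ⟩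
    - signVal (a xor b) + signVal (a xor b)              ≈⟨ -‿inverseˡ _ ⟩
    0#                                                   ∎

  norm : O → Carrier
  norm Z = ∑ᵥ (λ P → Z P * Z P)

  norm-cong : ∀ {Z W} → (∀ P → Z P ≈ W P) → norm Z ≈ norm W
  norm-cong Z≈W = ∑ᵥ-cong λ P → *-cong (Z≈W P) (Z≈W P)

  N≈norm : ∀ Z → N Z ≈ norm Z
  N≈norm Z = ≈-reflexive (∑ᵥ-def _)

  -- Expansion of the norm of a product.

  module _ (F : FanoPlane) (e : MultFactor) where

    product : O → O → O
    product Z W R = ∑ᵥ (λ P → ∑ᵥ (λ Q → (Z P * W Q) * baseCoeff F e P Q R))

    opaque
      unfolding ∑ᵥ

      mul≈product : ∀ Z W R → mul F e Z W R ≈ product Z W R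
      mul≈product Z W R = ≈-refl

    sign : V → V → Carrier
    sign P Q = signVal (baseSign e P Q)

    baseCoeff-≡ : ∀ {P Q R} → addV F P Q ≡ R → baseCoeff F e P Q R ≡ sign P Q
    baseCoeff-≡ {P} {Q} {R} eq with ≡-dec _≟_ (addV F P Q) R
    ... | yes _ = refl
    ... | no  ≢ = contradiction eq ≢

    baseCoeff-≢ : ∀ {P Q R} → addV F P Q ≢ R → baseCoeff F e P Q R ≡ 0#
    baseCoeff-≢ {P} {Q} {R} ≢ with ≡-dec _≟_ (addV F P Q) R
    ... | yes eq = contradiction eq ≢
    ... | no  _  = refl

    ∑ᵥ-baseCoeff : ∀ P Q (g : O) → ∑ᵥ (λ R → baseCoeff F e P Q R * g R) ≈ sign P Q * g (addV F P Q)
    ∑ᵥ-baseCoeff P Q g = ≈-trans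
      (∑ᵥ-single (addV F P Q) λ R ≢ → ≈-trans (*-congʳ (≈-reflexive (baseCoeff-≢ {P} {Q} ≢))) (zeroˡ _))
      (*-congʳ (≈-reflexive (baseCoeff-≡ {P} {Q} refl)))

    -- The inner product of e_P e_Q and e_P′ e_Q′.
    gram : V → V → V → V → Carrier
    gram P P′ Q Q′ = sign P Q * baseCoeff F e P′ Q′ (addV F P Q)

    gram-≡ : ∀ {P P′ Q Q′} → addV F P′ Q′ ≡ addV F P Q → gram P P′ Q Q′ ≈ sign P Q * sign P′ Q′
    gram-≡ {P′ = P′} {Q′ = Q′} eq = *-congˡ (≈-reflexive (baseCoeff-≡ {P′} {Q′} eq))

    gram-≢ : ∀ {P P′ Q Q′} → addV F P′ Q′ ≢ addV F P Q → gram P P′ Q Q′ ≈ 0#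
    gram-≢ {P′ = P′} {Q′ = Q′} ≢ = ≈-trans (*-congˡ (≈-reflexive (baseCoeff-≢ {P′} {Q′} ≢))) (zeroʳ _)

    gram-diagonal : ∀ P Q → gram P P Q Q ≈ 1#
    gram-diagonal P Q = begin
      gram P P Q Q            ≈⟨ gram-≡ {P} {P} {Q} {Q} refl ⟩
      sign P Q * sign P Q     ≈⟨ signVal-* s s ⟩
      signVal (not (s xor s)) ≡⟨ cong (signVal ∘ not) (xor-same s) ⟩
      1#                      ∎
      where s = baseSign e P Q

    -- Either both terms are products of signs, which cancel by the sign rule, or both vanish: if
    -- the second did not, exchanging Q and Q′ in `addV-crossed` would make the targets of the first
    -- agree.
    gram-antisym : Alternating F (MultFactor.ε e) → ∀ {P P′} → P ≢ P′ → ∀ Q Q′ →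
                   gram P P′ Q Q′ + gram P P′ Q′ Q ≈ 0#
    gram-antisym alt {P} {P′} P≢P′ Q Q′ with ≡-dec _≟_ (addV F P Q) (addV F P′ Q′)
    ... | yes eq = let eq′ , signs = addV-crossed F e alt {P} {Q} P≢P′ eq in
      ≈-trans (+-cong (gram-≡ {P} {P′} {Q} {Q′} (sym eq)) (gram-≡ {P} {P′} {Q′} {Q} (sym eq′)))
              (signVal-cancel {baseSign e P Q} {c = baseSign e P Q′} {baseSign e P′ Q} signs)
    ... | no ≢ = ≈-trans
      (+-cong (gram-≢ {P} {P′} {Q} {Q′} (≢-sym ≢))
              (gram-≢ {P} {P′} {Q′} {Q} λ eq → ≢ (proj₁ (addV-crossed F e alt {P} {Q′} P≢P′ (sym eq)))))
      (+-identityˡ 0#)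

    module _ (W : O) where

      -- The inner product of e_P W and e_P′ W, expanded in the coordinates of W.
      polar : V → V → Carrier
      polar P P′ = ∑ᵥ (λ Q → ∑ᵥ (λ Q′ → (W Q * W Q′) * gram P P′ Q Q′))

      -- Left multiplication by e_P permutes the basis up to sign, so it preserves the norm.
      polar-diagonal : ∀ P → polar P P ≈ norm W
      polar-diagonal P = ∑ᵥ-cong λ Q → begin
        ∑ᵥ (λ Q′ → (W Q * W Q′) * gram P P Q Q′)
          ≈⟨ ∑ᵥ-single Q (λ Q′ Q≢Q′ → ≈-trans
               (*-congˡ (gram-≢ {P} {P} {Q} {Q′} λ eq → Q≢Q′ (sym (addV-cancelˡ F e {P} eq)))) (zeroʳ _)) ⟩
        (W Q * W Q) * gram P P Q Q  ≈⟨ *-congˡ (gram-diagonal P Q) ⟩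
        (W Q * W Q) * 1#            ≈⟨ *-identityʳ _ ⟩
        W Q * W Q                   ∎

      -- The second copy is summed with Q and Q′ interchanged; the weight W Q * W Q′ is symmetric
      -- and `gram` antisymmetric, so the terms cancel in pairs. Characteristic not 2 later turns
      -- this into orthogonality of e_P W and e_P′ W.
      polar-double : Alternating F (MultFactor.ε e) → ∀ {P P′} → P ≢ P′ → polar P P′ + polar P P′ ≈ 0#
      polar-double alt {P} {P′} P≢P′ = begin
        polar P P′ + polar P P′
          ≈⟨ +-congˡ (∑ᵥ-comm (λ Q Q′ → (W Q * W Q′) * gram P P′ Q Q′)) ⟩
        polar P P′ + ∑ᵥ (λ Q → ∑ᵥ (λ Q′ → (W Q′ * W Q) * gram P P′ Q′ Q))
          ≈⟨ ∑ᵥ-+ _ _ ⟨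
        ∑ᵥ (λ Q → ∑ᵥ (λ Q′ → (W Q * W Q′) * gram P P′ Q Q′) + ∑ᵥ (λ Q′ → (W Q′ * W Q) * gram P P′ Q′ Q))
          ≈⟨ ∑ᵥ-zero (λ Q → ≈-trans (≈-sym (∑ᵥ-+ _ _)) (∑ᵥ-zero (λ Q′ → begin
               (W Q * W Q′) * gram P P′ Q Q′ + (W Q′ * W Q) * gram P P′ Q′ Q
                 ≈⟨ +-congˡ (*-congʳ (*-comm _ _)) ⟩
               (W Q * W Q′) * gram P P′ Q Q′ + (W Q * W Q′) * gram P P′ Q′ Q
                 ≈⟨ distribˡ _ _ _ ⟨
               (W Q * W Q′) * (gram P P′ Q Q′ + gram P P′ Q′ Q)
                 ≈⟨ *-congˡ (gram-antisym alt P≢P′ Q Q′) ⟩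
               (W Q * W Q′) * 0#
                 ≈⟨ zeroʳ _ ⟩
               0# ∎))) ⟩
        0# ∎

      -- Only one factor of each square is expanded at first. The sum over R then collapses to R = P
      -- + Q, and the other factor is expanded at that single point.
      norm-expand : ∀ Z → norm (product Z W) ≈ ∑ᵥ (λ P → ∑ᵥ (λ P′ → (Z P * Z P′) * polar P P′))
      norm-expand Z = begin
        ∑ᵥ (λ R → m R * m R)
          ≈⟨ ∑ᵥ-cong (λ R → ≈-trans (∑ᵥ-*ʳ (m R) _) (∑ᵥ-cong λ P → ∑ᵥ-*ʳ (m R) _)) ⟩
        ∑ᵥ (λ R → ∑ᵥ (λ P → ∑ᵥ (λ Q → ((Z P * W Q) * baseCoeff F e P Q R) * m R)))
          ≈⟨ ∑ᵥ-comm _ ⟩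
        ∑ᵥ (λ P → ∑ᵥ (λ R → ∑ᵥ (λ Q → ((Z P * W Q) * baseCoeff F e P Q R) * m R)))
          ≈⟨ ∑ᵥ-cong (λ P → ≈-trans (∑ᵥ-comm _) (∑ᵥ-cong (contract P))) ⟩
        ∑ᵥ (λ P → ∑ᵥ (λ Q → ∑ᵥ (λ P′ → ∑ᵥ (λ Q′ → (Z P * Z P′) * ((W Q * W Q′) * gram P P′ Q Q′)))))
          ≈⟨ ∑ᵥ-cong (λ P → ∑ᵥ-comm _) ⟩
        ∑ᵥ (λ P → ∑ᵥ (λ P′ → ∑ᵥ (λ Q → ∑ᵥ (λ Q′ → (Z P * Z P′) * ((W Q * W Q′) * gram P P′ Q Q′)))))
          ≈⟨ ∑ᵥ-cong (λ P → ∑ᵥ-cong λ P′ → ≈-trans (∑ᵥ-*ˡ _ _) (∑ᵥ-cong λ Q → ∑ᵥ-*ˡ _ _)) ⟨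
        ∑ᵥ (λ P → ∑ᵥ (λ P′ → (Z P * Z P′) * polar P P′)) ∎
        where
        m = product Z W
        contract : ∀ P Q → ∑ᵥ (λ R → ((Z P * W Q) * baseCoeff F e P Q R) * m R) ≈
                   ∑ᵥ (λ P′ → ∑ᵥ (λ Q′ → (Z P * Z P′) * ((W Q * W Q′) * gram P P′ Q Q′)))
        contract P Q = begin
          ∑ᵥ (λ R → ((Z P * W Q) * baseCoeff F e P Q R) * m R)
            ≈⟨ ∑ᵥ-cong (λ R → *-assoc _ _ _) ⟩
          ∑ᵥ (λ R → (Z P * W Q) * (baseCoeff F e P Q R * m R))
            ≈⟨ ∑ᵥ-*ˡ _ _ ⟨
          (Z P * W Q) * ∑ᵥ (λ R → baseCoeff F e P Q R * m R)
            ≈⟨ *-congˡ (∑ᵥ-baseCoeff P Q m) ⟩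
          (Z P * W Q) * (sign P Q * m (addV F P Q))
            ≈⟨ *-assoc _ _ _ ⟨
          ((Z P * W Q) * sign P Q) * m (addV F P Q)
            ≈⟨ ≈-trans (∑ᵥ-*ˡ _ _) (∑ᵥ-cong λ P′ → ≈-trans (∑ᵥ-*ˡ _ _) (∑ᵥ-cong λ Q′ →
                 solve 6 (λ z w s z′ w′ b →
                   ((z ⊕ w) ⊕ s) ⊕ ((z′ ⊕ w′) ⊕ b) ⊜ (z ⊕ z′) ⊕ ((w ⊕ w′) ⊕ (s ⊕ b)))
                   ≈-refl (Z P) (W Q) (sign P Q) (Z P′) (W Q′) (baseCoeff F e P′ Q′ (addV F P Q)))) ⟩
          ∑ᵥ (λ P′ → ∑ᵥ (λ Q′ → (Z P * Z P′) * ((W Q * W Q′) * gram P P′ Q Q′))) ∎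

    module _ (isField : IsField 𝔽) (char≢2 : CharNot2 𝔽) where

      double-zero : ∀ {x} → x + x ≈ 0# → x ≈ 0#
      double-zero {x} x+x≈0 with h , 2h≈1 ← IsField.inverse isField (1# + 1#) char≢2 = begin
        x                     ≈⟨ *-identityˡ x ⟨
        1# * x                ≈⟨ *-congʳ 2h≈1 ⟨
        ((1# + 1#) * h) * x   ≈⟨ *-congʳ (*-comm _ h) ⟩
        (h * (1# + 1#)) * x   ≈⟨ *-assoc _ _ _ ⟩
        h * ((1# + 1#) * x)   ≈⟨ *-congˡ (≈-trans (distribʳ x 1# 1#) (+-cong (*-identityˡ x) (*-identityˡ x))) ⟩
        h * (x + x)           ≈⟨ *-congˡ x+x≈0 ⟩
        h * 0#                ≈⟨ zeroʳ h ⟩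
        0#                    ∎

      -- Pythagoras: ZW is the combination of the vectors e_P W with coefficients Z P, and these
      -- vectors are pairwise orthogonal, each of the norm of W.
      norm-product : Alternating F (MultFactor.ε e) → ∀ Z W → norm (product Z W) ≈ norm Z * norm W
      norm-product alt Z W = begin
        norm (product Z W)
          ≈⟨ norm-expand W Z ⟩
        ∑ᵥ (λ P → ∑ᵥ (λ P′ → (Z P * Z P′) * polar W P P′))
          ≈⟨ ∑ᵥ-cong (λ P → ∑ᵥ-single P λ P′ P≢P′ →
               ≈-trans (*-congˡ (double-zero (polar-double W alt P≢P′))) (zeroʳ _)) ⟩
        ∑ᵥ (λ P → (Z P * Z P) * polar W P P)
          ≈⟨ ∑ᵥ-cong (λ P → *-congˡ (polar-diagonal W P)) ⟩
        ∑ᵥ (λ P → (Z P * Z P) * norm W)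
          ≈⟨ ∑ᵥ-*ʳ _ _ ⟨
        norm Z * norm W ∎

      alternating⇒composition : Alternating F (MultFactor.ε e) → IsCompositionAlgebra F e
      alternating⇒composition alt Z W = begin
        N (mul F e Z W)      ≈⟨ N≈norm (mul F e Z W) ⟩
        norm (mul F e Z W)   ≈⟨ norm-cong (mul≈product Z W) ⟩
        norm (product Z W)   ≈⟨ norm-product alt Z W ⟩
        norm Z * norm W      ≈⟨ *-cong (N≈norm Z) (N≈norm W) ⟨
        N Z * N W            ∎

theorem4p4 : {c ℓ : Level} (𝔽 : CommutativeRing c ℓ) → IsField 𝔽 → CharNot2 𝔽 →
    (F : FanoPlane) (e : MultFactor) →
    ((∀ P → IsLine F (future e P)) ⊎ (∀ P → IsLine F (past e P))) →
    Algebra.IsCompositionAlgebra 𝔽 F e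
theorem4p4 𝔽 isField char≢2 F e lines =
  Composition.alternating⇒composition 𝔽 F e isField char≢2 (lines⇒alternating F e lines)
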